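{- Let $n,k,H$ be nonnegative integers with $H\le k/2$ and $n\ge1$. In the problem MinCyclic, there is an algorithm using $k$ comparison queries, at most $H$ of whose answers may be erroneous, that outputs an index $j\in\{0,\dots,n-1\}$ with \[ A[j]\ \le\ \Big\lceil \frac{n\sum_{i=0}^{H}\binom{k-H}{i}}{2^{k-H}}\Big\rceil . \]
   Context: MinCyclic: the input is an array $A[0\dots n-1]$ whose entries form an unknown cyclic rotation of $(0,1,\dots,n-1)$, i.e. there is an unknown index $x$ with $A[j]=(j-x)\bmod n$ for all $j$ (so $A[x]=0$). The algorithm adaptively asks $k$ comparison queries, each of the form "is $x\le B$?" for an integer $B$ of its choice; an adversary answers, and may answer incorrectly at most $H$ of the $k$ queries, where $H$ is known to the algorithm. After the $k$ answers the algorithm outputs an index $j$, aiming to make $A[j]$ as small as possible; the guarantee must hold for every $x$ and every admissible pattern of answers. -}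

module Defs where

open import Data.Nat using (ℕ; zero; suc; _+_; _*_; _∸_; _^_; _≤_; _≤ᵇ_; _/_)
open import Data.Nat.Properties using (m^n≢0)
open import Data.Nat.Combinatorics using (_C_)
open import Data.Integer as ℤ using (ℤ; +_)
open import Data.Integer.Properties as ℤP using ()
open import Data.Fin using (Fin; toℕ)
open import Data.Vec using (Vec; []; _∷_)
open import Data.List using (List; map; upTo)
open import Data.Nat.ListAction using (sum)
open import Data.Bool using (Bool; true; false; if_then_else_)
open import Relation.Nullary.Decidable using (⌊_⌋)

-- The array of MinCyclic with hidden rotation x : A[j] = (j - x) mod n
-- (written out for j, x ∈ {0,…,n-1}).
cyc : (n : ℕ) → (x j : Fin n) → ℕ
cyc n x j = if toℕ x ≤ᵇ toℕ j then toℕ j ∸ toℕ x else (toℕ j + n) ∸ toℕ x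

-- Adaptive comparison-query algorithm with exactly k queries:
-- a binary decision tree of depth k; each node asks "is x ≤ B ?" (B ∈ ℤ),
-- the left subtree is used after answer "yes" (true), the right after "no".
-- Leaves output an index j ∈ Fin n.
data Algo (n : ℕ) : ℕ → Set where
  output : Fin n → Algo n zero
  ask    : ∀ {k} → ℤ → (ifYes ifNo : Algo n k) → Algo n (suc k)

truth : ∀ {n} → Fin n → ℤ → Bool
truth x B = ⌊ (+ toℕ x) ℤ.≤? B ⌋

run : ∀ {n k} → Algo n k → Vec Bool k → Fin n
run (output j) [] = j
run (ask B t f) (true ∷ as) = run t as
run (ask B t f) (false ∷ as) = run f as

errors : ∀ {n k} → Fin n → Algo n k → Vec Bool k → ℕ
errors x (output j) [] = 0
errors x (ask B t f) (a ∷ as) =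
  (if a Data.Bool.xor truth x B then 1 else 0) + errors x (if a then t else f) as

ceilDivPow2 : ℕ → ℕ → ℕ
ceilDivPow2 a m = (a + (2 ^ m ∸ 1)) / (2 ^ m)
  where instance _ = m^n≢0 2 m

bound : (n k H : ℕ) → ℕ
bound n k H = ceilDivPow2 (n * sum (map (λ i → (k ∸ H) C i) (upTo (suc H)))) (k ∸ H)

{-# OPTIONS --safe #-}
module Submission where

-- The consistent points after any prefix of answers are those x with lo x < hi x
-- for two monotone functions, since a "yes" speaks against an upper set and a
-- "no" against a lower set. Give a point with g remaining lies and q remaining
-- queries the Berlekamp weight Σ_{i<g} C(q,i); then k ∸ H queries can be placed
-- so that every answer halves the total weight. This requires cuts between
-- integers, so each array index is refined into N points, N large enough to
-- absorb the rounding of the halving. The surviving points number about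
-- N · bound, but may form several components; monotonicity makes the intervals
-- [lo x, hi x) ⊆ [0, H + 1) of distinct components disjoint, so H further
-- queries, each placed in a gap, leave a single component, whose right end is
-- output.

open import Defs
open import Data.Nat using (ℕ; zero; suc; pred; _+_; _*_; _∸_; _^_; _/_; _%_; _≤_; _<_; _≤ᵇ_; z≤n; s≤s; s<s⁻¹; s≤s⁻¹; _<?_; _≤?_; NonZero)
open import Data.Nat.Properties
open import Data.Nat.DivMod using (m≡m%n+[m/n]*n; m%n<n; m*n/n≡m; m/n*n≤m; /-monoˡ-≤)
open import Data.Nat.Combinatorics using (_C_; nCk+nC[k+1]≡[n+1]C[k+1]; k>n⇒nCk≡0)
open import Data.Nat.ListAction using (sum)
open import Data.Nat.ListAction.Properties using (sum-++)
open import Data.Nat.Tactic.RingSolver using (solve-∀)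
open import Data.Integer as ℤ using (ℤ; -[1+_])
open import Data.Fin using (Fin; toℕ; fromℕ<)
open import Data.Fin.Properties using (toℕ<n; toℕ-fromℕ<)
open import Data.Vec using (Vec; []; _∷_)
open import Data.List using (map; upTo; _∷ʳ_)
open import Data.List.Properties using (upTo-∷ʳ; map-++)
open import Data.Bool using (Bool; true; false)
open import Data.Product using (Σ; ∃; _×_; _,_; proj₁; proj₂)
open import Data.Sum using (_⊎_; inj₁; inj₂; [_,_]′)
open import Function using (_∘_; const)
open import Relation.Nullary using (¬_; yes; no; contradiction)
open import Relation.Nullary.Decidable using (_×-dec_; dec-true; dec-false; isYes≗does)
open import Relation.Unary using (Decidable)
open import Relation.Binary.Definitions using (tri<; tri≈; tri>)
open import Relation.Binary.PropositionalEquality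

-- Finite sums

total : (ℕ → ℕ) → ℕ → ℕ
total f zero    = 0
total f (suc n) = total f n + f n

total-mono : ∀ {f g} → (∀ i → f i ≤ g i) → ∀ n → total f n ≤ total g n
total-mono f≤g zero    = z≤n
total-mono f≤g (suc n) = +-mono-≤ (total-mono f≤g n) (f≤g n)

total-cong : ∀ {f g} → (∀ i → f i ≡ g i) → ∀ n → total f n ≡ total g n
total-cong f≡g zero    = refl
total-cong f≡g (suc n) = cong₂ _+_ (total-cong f≡g n) (f≡g n)

+-interchange : ∀ a b c d → (a + b) + (c + d) ≡ (a + c) + (b + d)
+-interchange = solve-∀

total-+ : ∀ f g n → total (λ i → f i + g i) n ≡ total f n + total g n
total-+ f g zero    = refl
total-+ f g (suc n) = trans (cong (_+ (f n + g n)) (total-+ f g n))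
                            (+-interchange (total f n) (total g n) (f n) (g n))

total-const : ∀ a n → total (const a) n ≡ n * a
total-const a zero    = refl
total-const a (suc n) = trans (cong (_+ a) (total-const a n)) (+-comm (n * a) a)

total-monoʳ : ∀ f {m n} → m ≤ n → total f m ≤ total f n
total-monoʳ f {n = zero}  z≤n = z≤n
total-monoʳ f {n = suc n} m≤1+n with m≤n⇒m<n∨m≡n m≤1+n
... | inj₁ m<1+n = ≤-trans (total-monoʳ f (s≤s⁻¹ m<1+n)) (m≤m+n _ _)
... | inj₂ refl  = ≤-refl

-- Each point strictly between `a` and `b` adds at least one to the sum. With `f` marking live
-- points, a bound on their number limits how long a stretch without gaps can be.
total-positive : ∀ f a b → (∀ y → a < y → y < b → 0 < f y) → b ≤ suc a + total f b
total-positive f a zero    pos = z≤n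
total-positive f a (suc b) pos with a <? b
... | no  a≮b = s≤s (≤-trans (≮⇒≥ a≮b) (m≤m+n a _))
... | yes a<b = begin
  suc b                         ≡⟨ +-comm 1 b ⟩
  b + 1                         ≤⟨ +-mono-≤ (total-positive f a b λ y a<y y<b → pos y a<y (m<n⇒m<1+n y<b)) (pos b a<b ≤-refl) ⟩
  (suc a + total f b) + f b     ≡⟨ +-assoc (suc a) (total f b) (f b) ⟩
  suc a + (total f b + f b)     ∎
  where open ≤-Reasoning

sum-map-upTo : ∀ f n → sum (map f (upTo n)) ≡ total f n
sum-map-upTo f zero    = refl
sum-map-upTo f (suc n) = begin
  sum (map f (upTo (suc n)))         ≡⟨ cong (sum ∘ map f) (upTo-∷ʳ n) ⟨
  sum (map f (upTo n ∷ʳ n))          ≡⟨ cong sum (map-++ f (upTo n) _) ⟩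
  sum (map f (upTo n) ∷ʳ f n)        ≡⟨ sum-++ (map f (upTo n)) _ ⟩
  sum (map f (upTo n)) + (f n + 0)   ≡⟨ cong₂ _+_ (sum-map-upTo f n) (+-identityʳ (f n)) ⟩
  total f n + f n                    ∎
  where open ≡-Reasoning

-- Cuts and Berlekamp weights

cut : {A : Set} → ℕ → (ℕ → A) → (ℕ → A) → ℕ → A
cut c f g x with x <? c
... | yes _ = f x
... | no  _ = g x

cut-< : ∀ {A : Set} {c x} (f g : ℕ → A) → x < c → cut c f g x ≡ f x
cut-< {c = c} {x} f g x<c with x <? c
... | yes _  = refl
... | no x≮c = contradiction x<c x≮c

cut-≮ : ∀ {A : Set} {c x} (f g : ℕ → A) → ¬ x < c → cut c f g x ≡ g x
cut-≮ {c = c} {x} f g x≮c with x <? c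
... | yes x<c = contradiction x<c x≮c
... | no _    = refl

total-cut-below : ∀ f g {c n} → n ≤ c → total (cut c f g) n ≡ total f n
total-cut-below f g {n = zero}  _   = refl
total-cut-below f g {n = suc n} n<c =
  cong₂ _+_ (total-cut-below f g (<⇒≤ n<c)) (cut-< f g n<c)

-- Moving the cut past `c` changes only the value at `c`, from `g c` to `f c`.
total-cut-suc : ∀ f g {d} c n → (∀ i → f i ≤ g i + d) →
  total (cut (suc c) f g) n ≤ total (cut c f g) n + d
total-cut-suc f g         c zero    f≤g+d = z≤n
total-cut-suc f g {d = d} c (suc n) f≤g+d with <-cmp n c
... | tri< n<c _ _ = begin
  total (cut (suc c) f g) (suc n)  ≡⟨ total-cut-below f g (m≤n⇒m≤1+n n<c) ⟩
  total f (suc n)                  ≡⟨ total-cut-below f g n<c ⟨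
  total (cut c f g) (suc n)        ≤⟨ m≤m+n _ d ⟩
  total (cut c f g) (suc n) + d    ∎
  where open ≤-Reasoning
... | tri≈ _ refl _ = begin
  total (cut (suc n) f g) (suc n)           ≡⟨ total-cut-below f g ≤-refl ⟩
  total f n + f n                           ≤⟨ +-monoʳ-≤ (total f n) (f≤g+d n) ⟩
  total f n + (g n + d)                     ≡⟨ +-assoc (total f n) (g n) d ⟨
  (total f n + g n) + d                     ≡⟨ cong₂ (λ a b → (a + b) + d) (total-cut-below f g {n} ≤-refl) (cut-≮ f g (n≮n n)) ⟨
  total (cut n f g) (suc n) + d             ∎
  where open ≤-Reasoning
... | tri> n≮c _ c<n = begin
  total (cut (suc c) f g) n + cut (suc c) f g n   ≡⟨ cong (total (cut (suc c) f g) n +_) (cut-≮ f g (≤⇒≯ c<n)) ⟩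
  total (cut (suc c) f g) n + g n                 ≤⟨ +-monoˡ-≤ (g n) (total-cut-suc f g c n f≤g+d) ⟩
  (total (cut c f g) n + d) + g n                 ≡⟨ m+n+o≡m+o+n (total (cut c f g) n) d (g n) ⟩
  (total (cut c f g) n + g n) + d                 ≡⟨ cong (λ z → (total (cut c f g) n + z) + d) (cut-≮ f g n≮c) ⟨
  total (cut c f g) (suc n) + d                   ∎
  where
  open ≤-Reasoning
  m+n+o≡m+o+n : ∀ m n o → (m + n) + o ≡ (m + o) + n
  m+n+o≡m+o+n = solve-∀

-- The number of ways to place fewer than `g` lies among `q` answers; an excluded point, `g = 0`,
-- weighs nothing.
V : ℕ → ℕ → ℕ
V q g = total (q C_) g

-- Pascal's rule: the next answer either agrees with the point or uses up a lie. Hence the total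
-- weights after "yes" and after "no" add up to the present one.
V-suc : ∀ q g → V (suc q) g ≡ V q g + V q (pred g)
V-suc q zero          = refl
V-suc q (suc zero)    = refl
V-suc q (suc (suc g)) = begin
  V (suc q) (suc g) + suc q C suc g                 ≡⟨ cong₂ _+_ (V-suc q (suc g)) (sym (trans (+-comm (q C suc g) _) (nCk+nC[k+1]≡[n+1]C[k+1] q g))) ⟩
  (V q (suc g) + V q g) + (q C suc g + q C g)       ≡⟨ +-interchange (V q (suc g)) (V q g) (q C suc g) (q C g) ⟩
  V q (suc (suc g)) + V q (suc g)                   ∎
  where open ≡-Reasoning

V-monoʳ : ∀ q {g h} → g ≤ h → V q g ≤ V q h
V-monoʳ q = total-monoʳ (q C_)

-- With no queries left the weight is the indicator of being live, so the total weight becomes a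
-- count.
V-zero-suc : ∀ g → V 0 (suc g) ≡ 1
V-zero-suc zero    = refl
V-zero-suc (suc g) = cong₂ _+_ (V-zero-suc g) (k>n⇒nCk≡0 {0} {suc g} (s≤s z≤n))

V≤2^ : ∀ q g → V q g ≤ 2 ^ q
V≤2^ zero    zero    = z≤n
V≤2^ zero    (suc g) = ≤-reflexive (V-zero-suc g)
V≤2^ (suc q) g       = begin
  V (suc q) g          ≡⟨ V-suc q g ⟩
  V q g + V q (pred g) ≤⟨ +-mono-≤ (V≤2^ q g) (V≤2^ q (pred g)) ⟩
  2 ^ q + 2 ^ q        ≡⟨ cong (λ z → 2 ^ q + z) (+-identityʳ (2 ^ q)) ⟨
  2 ^ suc q            ∎
  where open ≤-Reasoning

discrete-ivt : ∀ (F G : ℕ → ℕ) n → F 0 ≤ G 0 →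
  (∃ λ c → F c ≤ G c × G (suc c) < F (suc c)) ⊎ F n ≤ G n
discrete-ivt F G zero    F0≤G0 = inj₂ F0≤G0
discrete-ivt F G (suc n) F0≤G0 with discrete-ivt F G n F0≤G0
... | inj₁ found = inj₁ found
... | inj₂ Fn≤Gn with F (suc n) ≤? G (suc n)
...   | yes le = inj₂ le
...   | no ¬le = inj₁ (n , Fn≤Gn , ≰⇒> ¬le)

total-cut-+ : ∀ f g c n →
  total (cut c f g) n + total (cut c g f) n ≡ total (λ i → f i + g i) n
total-cut-+ f g c n = trans (sym (total-+ (cut c f g) (cut c g f) n)) (total-cong pointwise n)
  where
  pointwise : ∀ i → cut c f g i + cut c g f i ≡ f i + g i
  pointwise i with i <? c
  ... | yes _ = refl
  ... | no  _ = +-comm (g i) (f i)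

-- The two totals always add up to `W`, and moving the cut by one changes each by at most `d`. Where
-- their order switches they therefore differ by at most `2 * d`.
balanced-cut : ∀ f g d n → (∀ i → g i ≤ f i) → (∀ i → f i ≤ g i + d) →
  let W = total (λ i → f i + g i) n in
  ∃ λ c → 2 * total (cut c f g) n ≤ W + 2 * d × 2 * total (cut c g f) n ≤ W + 2 * d
balanced-cut f g d n g≤f f≤g+d = choose (discrete-ivt F G n (total-mono g≤f n))
  where
  open ≤-Reasoning
  W : ℕ
  W = total (λ i → f i + g i) n
  F G : ℕ → ℕ
  F c = total (cut c f g) n
  G c = total (cut c g f) n

  2*≤W : ∀ {a b} → a + b ≡ W → a ≤ b → 2 * a ≤ W + 2 * d
  2*≤W {a} {b} a+b≡W a≤b = begin
    a + (a + 0)  ≤⟨ +-monoʳ-≤ a (≤-trans (≤-reflexive (+-identityʳ a)) a≤b) ⟩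
    a + b        ≡⟨ a+b≡W ⟩
    W            ≤⟨ m≤m+n W (2 * d) ⟩
    W + 2 * d    ∎

  F+G : ∀ c → F c + G c ≡ W
  F+G c = total-cut-+ f g c n

  G-step : ∀ c → G c ≤ G (suc c) + d
  G-step c = +-cancelˡ-≤ (F c) _ _ (begin
    F c + G c               ≡⟨ trans (F+G c) (sym (F+G (suc c))) ⟩
    F (suc c) + G (suc c)   ≤⟨ +-monoˡ-≤ (G (suc c)) (total-cut-suc f g c n f≤g+d) ⟩
    (F c + d) + G (suc c)   ≡⟨ regroup (F c) d (G (suc c)) ⟩
    F c + (G (suc c) + d)   ∎)
    where
    regroup : ∀ x y z → (x + y) + z ≡ x + (z + y)
    regroup = solve-∀

  choose : (∃ λ c → F c ≤ G c × G (suc c) < F (suc c)) ⊎ F n ≤ G n →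
           ∃ λ c → 2 * F c ≤ W + 2 * d × 2 * G c ≤ W + 2 * d
  choose (inj₁ (c , Fc≤Gc , G<F)) = c , 2*≤W (F+G c) Fc≤Gc , (begin
    G c + (G c + 0)         ≡⟨ cong (G c +_) (+-identityʳ (G c)) ⟩
    G c + G c               ≤⟨ +-monoʳ-≤ (G c) (G-step c) ⟩
    G c + (G (suc c) + d)   ≤⟨ +-monoʳ-≤ (G c) (+-monoˡ-≤ d (<⇒≤ G<F)) ⟩
    G c + (F (suc c) + d)   ≤⟨ +-monoʳ-≤ (G c) (+-monoˡ-≤ d (total-cut-suc f g c n f≤g+d)) ⟩
    G c + ((F c + d) + d)   ≡⟨ regroup (G c) (F c) d ⟩
    (F c + G c) + 2 * d     ≡⟨ cong (_+ 2 * d) (F+G c) ⟩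
    W + 2 * d               ∎)
    where
    regroup : ∀ x y z → x + ((y + z) + z) ≡ (y + x) + 2 * z
    regroup = solve-∀
  -- If the order never switches, the cut at `n` gives the totals of `f` and of `g` themselves, and
  -- `g ≤ f` supplies the reverse inequality.
  choose (inj₂ Fn≤Gn) = n , 2*≤W (F+G n) Fn≤Gn ,
    2*≤W (trans (+-comm (G n) (F n)) (F+G n)) (begin
      G n         ≡⟨ total-cut-below g f {n} ≤-refl ⟩
      total g n   ≤⟨ total-mono g≤f n ⟩
      total f n   ≡⟨ total-cut-below f g {n} ≤-refl ⟨
      F n         ∎)

weight : ℕ → (ℕ → ℕ) → ℕ → ℕ
weight q g = total (V q ∘ g)

-- A single point weighs at most `2 ^ q`, which serves as `d`. Divided by `2 ^ q` with `q` queries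
-- left, the total weight thus grows by at most one per query.
halving-cut : ∀ q g n → ∃ λ c →
  2 * weight q (cut c g (pred ∘ g)) n ≤ weight (suc q) g n + 2 ^ suc q ×
  2 * weight q (cut c (pred ∘ g) g) n ≤ weight (suc q) g n + 2 ^ suc q
halving-cut q g n =
  let c , yes≤ , no≤ = balanced-cut (V q ∘ g) (V q ∘ pred ∘ g) (2 ^ q) n
                         (λ i → V-monoʳ q (pred[n]≤n {g i}))
                         (λ i → ≤-trans (V≤2^ q (g i)) (m≤n+m _ _))
  in c , convert (V-cut c g (pred ∘ g)) yes≤ , convert (V-cut c (pred ∘ g) g) no≤
  where
  W : ℕ
  W = total (λ i → V q (g i) + V q (pred (g i))) n
  W≡ : W ≡ weight (suc q) g n
  W≡ = total-cong (λ i → sym (V-suc q (g i))) n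
  V-cut : ∀ c f h i → V q (cut c f h i) ≡ cut c (V q ∘ f) (V q ∘ h) i
  V-cut c f h i with i <? c
  ... | yes _ = refl
  ... | no  _ = refl
  convert : ∀ {f h} → (∀ i → f i ≡ h i) → 2 * total h n ≤ W + 2 ^ suc q →
            2 * total f n ≤ weight (suc q) g n + 2 ^ suc q
  convert f≡h = subst₂ (λ a b → 2 * a ≤ b + 2 ^ suc q) (sym (total-cong f≡h n)) W≡

-- Bounded search and truncated subtraction

largest : ∀ {P : ℕ → Set} → Decidable P → ∀ n →
  (∃ λ r → r < n × P r × (∀ x → x < n → P x → x ≤ r)) ⊎ (∀ x → x < n → ¬ P x)
largest P? zero    = inj₂ λ _ ()
largest P? (suc n) with P? n
... | yes Pn = inj₁ (n , ≤-refl , Pn , λ x x<1+n _ → s≤s⁻¹ x<1+n)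
... | no ¬Pn with largest P? n
...   | inj₁ (r , r<n , Pr , max) = inj₁ (r , m<n⇒m<1+n r<n , Pr , λ x x<1+n Px →
          [ (λ x<n → max x x<n Px) , (λ { refl → contradiction Px ¬Pn }) ]′ (m<1+n⇒m<n∨m≡n x<1+n))
...   | inj₂ none = inj₂ λ x x<1+n Px →
          [ (λ x<n → none x x<n Px) , (λ { refl → ¬Pn Px }) ]′ (m<1+n⇒m<n∨m≡n x<1+n)

0<m∸n⇒n<m : ∀ {m n} → 0 < m ∸ n → n < m
0<m∸n⇒n<m = m∸n≢0⇒n<m ∘ >⇒≢

pred-∸ : ∀ a b → pred (b ∸ a) ≡ pred b ∸ a
pred-∸ a b = trans (pred[m∸n]≡m∸[1+n] b a) (sym (∸-+-assoc b 1 a))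

-- Strategies

-- The point x of the array is placed at x * N, so that cuts can be made at a
-- resolution of 1/N; g counts how many answers may still be blamed before a
-- point is excluded, with 0 meaning that it already is.
module Game (n N L : ℕ) .{{_ : NonZero N}} where

  position : Fin n → ℕ
  position x = toℕ x * N

  -- The strict bound imposes nothing on points with budget 0, so `g` alone records the state of the
  -- game.
  Strategy : (ℕ → ℕ) → ℕ → Set
  Strategy g q = Σ (Algo n q) λ alg → ∀ x as →
    errors x alg as < g (position x) → cyc n x (run alg as) ≤ L

  -- `x * N < suc c` amounts to `x ≤ c / N`; the cut at 0 has nothing below it and becomes a
  -- comparison with -1.
  threshold : ℕ → ℤ
  threshold zero    = -[1+ 0 ]
  threshold (suc c) = ℤ.+ (c / N)

  truth-below : ∀ x c → position x < c → truth x (threshold c) ≡ true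
  truth-below x (suc c) xN<1+c = trans (isYes≗does _) (dec-true (ℤ.+ toℕ x ℤ.≤? threshold (suc c)) (ℤ.+≤+ (begin
    toℕ x           ≡⟨ m*n/n≡m (toℕ x) N ⟨
    toℕ x * N / N   ≤⟨ /-monoˡ-≤ N (s≤s⁻¹ xN<1+c) ⟩
    c / N           ∎)))
    where open ≤-Reasoning

  truth-above : ∀ x c → ¬ position x < c → truth x (threshold c) ≡ false
  truth-above x zero    _ = refl
  truth-above x (suc c) xN≮1+c = trans (isYes≗does _) (dec-false (ℤ.+ toℕ x ℤ.≤? threshold (suc c)) λ { (ℤ.+≤+ x≤c/N) →
    xN≮1+c (s≤s (≤-trans (*-monoˡ-≤ N x≤c/N) (m/n*n≤m c N))) })

  1+m<n⇒m<pred[n] : ∀ {m n} → suc m < n → m < pred n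
  1+m<n⇒m<pred[n] {n = suc n} = s<s⁻¹

  -- A "yes" charges one lie to every point from `c` on, a "no" to every point below `c`.
  ask-cut : ∀ {g q} c → Strategy (cut c g (pred ∘ g)) q → Strategy (cut c (pred ∘ g) g) q →
            Strategy g (suc q)
  ask-cut {g} c (ifYes , yes-ok) (ifNo , no-ok) = ask (threshold c) ifYes ifNo , ok
    where
    ok : ∀ x as → errors x (ask (threshold c) ifYes ifNo) as < g (position x) →
         cyc n x (run (ask (threshold c) ifYes ifNo) as) ≤ L
    ok x as few with position x <? c
    ok x (true  ∷ as) few | yes p rewrite truth-below x c p =
      yes-ok x as (subst (_ <_) (sym (cut-< g (pred ∘ g) p)) few)
    ok x (false ∷ as) few | yes p rewrite truth-below x c p =
      no-ok x as (subst (_ <_) (sym (cut-< (pred ∘ g) g p)) (1+m<n⇒m<pred[n] few))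
    ok x (true  ∷ as) few | no ¬p rewrite truth-above x c ¬p =
      yes-ok x as (subst (_ <_) (sym (cut-≮ g (pred ∘ g) ¬p)) (1+m<n⇒m<pred[n] few))
    ok x (false ∷ as) few | no ¬p rewrite truth-above x c ¬p =
      no-ok x as (subst (_ <_) (sym (cut-≮ (pred ∘ g) g ¬p)) few)

  weaken : ∀ {g h q} → (∀ i → g i ≤ h i) → Strategy h q → Strategy g q
  weaken g≤h (alg , ok) = alg , λ x as few → ok x as (<-≤-trans few (g≤h _))

  -- The depth of an `Algo` is fixed, so an early decision is padded with queries whose answers are
  -- ignored.
  constantly : Fin n → ∀ q → Algo n q
  constantly j zero    = output j
  constantly j (suc q) = ask (ℤ.+ 0) (constantly j q) (constantly j q)

  run-constantly : ∀ j {q} (as : Vec Bool q) → run (constantly j q) as ≡ j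
  run-constantly j []           = refl
  run-constantly j (true  ∷ as) = run-constantly j as
  run-constantly j (false ∷ as) = run-constantly j as

  stop : ∀ g j → (∀ x → 0 < g (position x) → cyc n x j ≤ L) → ∀ q → Strategy g q
  stop g j near q = constantly j q , λ x as few →
    subst (λ i → cyc n x i ≤ L) (sym (run-constantly j as)) (near x (≤-<-trans z≤n few))

  cyc-≤ : ∀ {x j : Fin n} → toℕ x ≤ toℕ j → cyc n x j ≡ toℕ j ∸ toℕ x
  cyc-≤ {x} {j} x≤j with toℕ x ≤ᵇ toℕ j | ≤⇒≤ᵇ x≤j
  ... | true | _ = refl

  -- Closing the gaps

  Alive : (α β : ℕ → ℕ) → ℕ → Set
  Alive α β x = α x < β x

  -- The i-th live point owns the interval [α i, β i) of errors. Between points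
  -- separated by a gap these intervals are disjoint, so a query in the gap
  -- shortens their common range [0, t) by one, whatever the answer.
  module Gaps (j₀ : Fin n) (Gap : ℕ → Set) (gap? : Decidable Gap)
    (gapless-short : ∀ {l r} → l ≤ r → r < n →
      (∀ y → l * N < y → y < r * N → ¬ Gap y) → r ∸ l ≤ L) where

    -- `y ≤ r` is not strict because a cut at `y` puts `y` itself on the upper side.
    Separated : (α β : ℕ → ℕ) → Set
    Separated α β = ∀ {l y r} → l < y → y ≤ r → Gap y → Alive α β l → Alive α β r → β l ≤ α r

    Within : ℕ → (α β : ℕ → ℕ) → Set
    Within t α β = ∀ {x} → Alive α β x → β x ≤ t

    LiveGap : (α β : ℕ → ℕ) → Set
    LiveGap α β = ∃ λ l → ∃ λ y → ∃ λ r → l < y × y < r × Gap y × Alive α β l × Alive α β r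

    -- The candidate output is the rightmost live index: no live `x` lies beyond it, so `cyc` is a
    -- plain difference and does not wrap around. If nothing is live, any index will do.
    stop-or-gap : ∀ α β → (∀ q → Strategy (λ x → β x ∸ α x) q) ⊎ LiveGap α β
    stop-or-gap α β with largest (λ x → α (x * N) <? β (x * N)) n
    ... | inj₂ none = inj₁ (stop (λ x → β x ∸ α x) j₀ λ x live →
      contradiction (0<m∸n⇒n<m live) (none (toℕ x) (toℕ<n x)))
    ... | inj₁ (r , r<n , r-live , r-max)
      with anyUpTo? (λ l → (α (l * N) <? β (l * N)) ×-dec
                           anyUpTo? (λ y → (l * N <? y) ×-dec gap? y) (r * N)) n
    ...   | yes (l , _ , l-live , y , y<r , l<y , gap) =
      inj₂ (l * N , y , r * N , l<y , y<r , gap , l-live , r-live)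
    ...   | no ¬live-gap = inj₁ (stop (λ x → β x ∸ α x) j near)
      where
      j : Fin n
      j = fromℕ< r<n
      near : ∀ x → 0 < β (position x) ∸ α (position x) → cyc n x j ≤ L
      near x live = begin
        cyc n x j       ≡⟨ cyc-≤ (subst (toℕ x ≤_) (sym (toℕ-fromℕ< r<n)) x≤r) ⟩
        toℕ j ∸ toℕ x   ≡⟨ cong (_∸ toℕ x) (toℕ-fromℕ< r<n) ⟩
        r ∸ toℕ x       ≤⟨ gapless-short x≤r r<n (λ y x<y y<r gap →
                             ¬live-gap (toℕ x , toℕ<n x , 0<m∸n⇒n<m live , y , y<r , x<y , gap)) ⟩
        L               ∎
        where
        open ≤-Reasoning
        x≤r : toℕ x ≤ r
        x≤r = r-max (toℕ x) (toℕ<n x) (0<m∸n⇒n<m live)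

    close-gaps : ∀ t α β → Within (suc t) α β → Separated α β → Strategy (λ x → β x ∸ α x) t
    close-gaps t α β within separated with stop-or-gap α β
    close-gaps t α β within separated | inj₁ stopped = stopped t
    -- Two live points on either side of a gap would need disjoint nonempty intervals inside [0, 1).
    close-gaps zero α β within separated | inj₂ (l , y , r , l<y , y<r , gap , l-live , r-live) =
      contradiction (begin-strict
        1     ≤⟨ ≤-<-trans z≤n l-live ⟩
        β l   ≤⟨ separated l<y (<⇒≤ y<r) gap l-live r-live ⟩
        α r   <⟨ r-live ⟩
        β r   ≤⟨ within r-live ⟩
        1     ∎) (<-irrefl refl)
      where open ≤-Reasoning
    close-gaps (suc t) α β within separated | inj₂ (l , y , r , l<y , y<r , gap , l-live , r-live) =
      ask-cut y
        (weaken yes-≤ (close-gaps t α β-yes yes-within yes-separated))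
        (weaken no-≤ (close-gaps t α-no (pred ∘ β) no-within no-separated))
      where
      g : ℕ → ℕ
      g x = β x ∸ α x

      -- After "yes" the intervals from `y` on lose their top, and those below are already capped by
      -- `α r`. After "no" the intervals below `y` lose their top, and the others slide down by one.
      β-yes α-no : ℕ → ℕ
      β-yes = cut y β (pred ∘ β)
      α-no  = cut y α (pred ∘ α)

      yes-≤ : ∀ x → cut y g (pred ∘ g) x ≤ β-yes x ∸ α x
      yes-≤ x with x <? y
      ... | yes _ = ≤-refl
      ... | no  _ = ≤-reflexive (pred-∸ (α x) (β x))

      β-yes≤β : ∀ x → β-yes x ≤ β x
      β-yes≤β x with x <? y
      ... | yes _ = ≤-refl
      ... | no  _ = pred[n]≤n

      yes-alive : ∀ {x} → Alive α β-yes x → Alive α β x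
      yes-alive {x} live = <-≤-trans live (β-yes≤β x)

      yes-within : Within (suc t) α β-yes
      yes-within {x} live with x <? y
      ... | yes x<y = s≤s⁻¹ (begin-strict
        β x          ≤⟨ separated x<y (<⇒≤ y<r) gap live r-live ⟩
        α r          <⟨ r-live ⟩
        β r          ≤⟨ within r-live ⟩
        suc (suc t)  ∎)
        where open ≤-Reasoning
      ... | no x≮y = pred-mono-≤ (within (<-≤-trans live pred[n]≤n))

      yes-separated : Separated α β-yes
      yes-separated {l′} l<z z<r gap′ l′-live r′-live =
        ≤-trans (β-yes≤β l′) (separated l<z z<r gap′ (yes-alive l′-live) (yes-alive r′-live))

      no-alive : ∀ {x} → Alive α-no (pred ∘ β) x → Alive α β x
      no-alive {x} live with x <? y
      ... | yes _ = <-≤-trans live pred[n]≤n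
      ... | no  _ = pred-cancel-< live

      no-within : Within (suc t) α-no (pred ∘ β)
      no-within live = pred-mono-≤ (within (no-alive live))

      pred-α≤α-no : ∀ x → pred (α x) ≤ α-no x
      pred-α≤α-no x with x <? y
      ... | yes _ = pred[n]≤n
      ... | no  _ = ≤-refl

      no-separated : Separated α-no (pred ∘ β)
      no-separated {r = r′} l<z z<r gap′ l′-live r′-live =
        ≤-trans (pred-mono-≤ (separated l<z z<r gap′ (no-alive l′-live) (no-alive r′-live)))
                (pred-α≤α-no r′)

      ∸-pred-pred : ∀ {a b} → (a < b → 0 < a) → b ∸ a ≤ pred b ∸ pred a
      ∸-pred-pred {suc a} {zero}  _   = z≤n
      ∸-pred-pred {suc a} {suc b} _   = ≤-refl
      ∸-pred-pred {zero}  {zero}  _   = z≤n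
      ∸-pred-pred {zero}  {suc b} 0<b = contradiction (0<b (s≤s z≤n)) λ ()

      no-≤ : ∀ x → cut y (pred ∘ g) g x ≤ pred (β x) ∸ α-no x
      no-≤ x with x <? y
      ... | yes _  = ≤-reflexive (pred-∸ (α x) (β x))
      -- Sliding keeps the length only if `α x` is positive; for a live `x`, separation from `l`
      -- gives `α x ≥ β l > 0`.
      ... | no x≮y = ∸-pred-pred λ live →
        <-≤-trans (≤-<-trans z≤n l-live) (separated l<y (≮⇒≥ x≮y) gap l-live live)

  -- Halving the weight

  Monotone : (ℕ → ℕ) → Set
  Monotone f = ∀ {x y} → x ≤ y → f x ≤ f y

  -- lo counts the "yes" answers speaking against a point, and suc H ∸ hi the
  -- "no" answers.
  module Halving (j₀ : Fin n) (H K : ℕ) (K-short : suc K < suc L * N) where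

    -- Gaps are the excluded positions. Monotonicity separates: `hi l ≤ hi y ≤ lo y ≤ lo r`. With at
    -- most `K` live positions, a gapless stretch between indices `l` and `r` has
    -- `(r ∸ l) * N ≤ suc K < suc L * N`.
    finish : ∀ lo hi → Monotone lo → Monotone hi → (∀ x → hi x ≤ suc H) →
             weight 0 (λ x → hi x ∸ lo x) (n * N) ≤ K → Strategy (λ x → hi x ∸ lo x) H
    finish lo hi lo-mono hi-mono hi≤ count≤K =
      close-gaps H lo hi (λ _ → hi≤ _)
        (λ l<y y≤r gap _ _ → ≤-trans (hi-mono (<⇒≤ l<y)) (≤-trans gap (lo-mono y≤r)))
      where
      live : ℕ → ℕ
      live x = V 0 (hi x ∸ lo x)

      live-positive : ∀ {x} → ¬ hi x ≤ lo x → 0 < live x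
      live-positive {x} hi≰lo with hi x ∸ lo x | m<n⇒0<n∸m (≰⇒> hi≰lo)
      ... | suc i | _ = ≤-reflexive (sym (V-zero-suc i))

      gapless-short : ∀ {l r} → l ≤ r → r < n →
        (∀ y → l * N < y → y < r * N → ¬ hi y ≤ lo y) → r ∸ l ≤ L
      gapless-short {l} {r} l≤r r<n gapless = s≤s⁻¹ (*-cancelʳ-< N (r ∸ l) (suc L) (begin-strict
        (r ∸ l) * N       ≡⟨ *-distribʳ-∸ N r l ⟩
        r * N ∸ l * N     ≤⟨ m≤n+o⇒m∸n≤o (r * N) (l * N) (begin
          r * N                             ≤⟨ total-positive live (l * N) (r * N) (λ y l<y y<r → live-positive (gapless y l<y y<r)) ⟩
          suc (l * N) + total live (r * N)  ≤⟨ +-monoʳ-≤ (suc (l * N)) (≤-trans (total-monoʳ live (*-monoˡ-≤ N (<⇒≤ r<n))) count≤K) ⟩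
          suc (l * N) + K                   ≡⟨ +-suc (l * N) K ⟨
          l * N + suc K                     ∎) ⟩
        suc K             <⟨ K-short ⟩
        suc L * N         ∎))
        where open ≤-Reasoning

      open Gaps j₀ (λ y → hi y ≤ lo y) (λ y → hi y ≤? lo y) gapless-short

    -- After division by `2 ^ q` the invariant says that the weight, plus one unit for each rounding
    -- still to come, is at most `K`. The other `H` queries are kept for the gaps.
    halve : ∀ q lo hi → Monotone lo → Monotone hi → (∀ x → hi x ≤ suc H) →
            weight q (λ x → hi x ∸ lo x) (n * N) + q * 2 ^ q ≤ K * 2 ^ q →
            Strategy (λ x → hi x ∸ lo x) (q + H)
    halve zero lo hi lo-mono hi-mono hi≤ W≤ =
      finish lo hi lo-mono hi-mono hi≤ (subst₂ _≤_ (+-identityʳ _) (*-identityʳ K) W≤)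
    halve (suc q) lo hi lo-mono hi-mono hi≤ W≤ =
      ask-cut c
        (weaken (≤-reflexive ∘ yes-≡) (halve q lo-yes hi lo-yes-mono hi-mono hi≤ (weight-ok yes-≡ yes-W)))
        (weaken (≤-reflexive ∘ no-≡) (halve q lo hi-no lo-mono hi-no-mono hi-no≤ (weight-ok no-≡ no-W)))
      where
      g : ℕ → ℕ
      g x = hi x ∸ lo x

      c : ℕ
      c = proj₁ (halving-cut q g (n * N))
      yes-W : 2 * weight q (cut c g (pred ∘ g)) (n * N) ≤ weight (suc q) g (n * N) + 2 ^ suc q
      yes-W = proj₁ (proj₂ (halving-cut q g (n * N)))
      no-W : 2 * weight q (cut c (pred ∘ g) g) (n * N) ≤ weight (suc q) g (n * N) + 2 ^ suc q
      no-W = proj₂ (proj₂ (halving-cut q g (n * N)))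

      -- Raising `lo` on an upper set and lowering `hi` on a lower set both preserve monotonicity.
      lo-yes hi-no : ℕ → ℕ
      lo-yes = cut c lo (suc ∘ lo)
      hi-no  = cut c (pred ∘ hi) hi

      yes-≡ : ∀ x → cut c g (pred ∘ g) x ≡ hi x ∸ lo-yes x
      yes-≡ x with x <? c
      ... | yes _ = refl
      ... | no  _ = pred[m∸n]≡m∸[1+n] (hi x) (lo x)

      no-≡ : ∀ x → cut c (pred ∘ g) g x ≡ hi-no x ∸ lo x
      no-≡ x with x <? c
      ... | yes _ = pred-∸ (lo x) (hi x)
      ... | no  _ = refl

      lo-yes-mono : Monotone lo-yes
      lo-yes-mono {x} {y} x≤y with x <? c | y <? c
      ... | yes _  | yes _   = lo-mono x≤y
      ... | yes _  | no _    = m≤n⇒m≤1+n (lo-mono x≤y)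
      ... | no x≮c | yes y<c = contradiction (≤-<-trans x≤y y<c) x≮c
      ... | no _   | no _    = s≤s (lo-mono x≤y)

      hi-no-mono : Monotone hi-no
      hi-no-mono {x} {y} x≤y with x <? c | y <? c
      ... | yes _  | yes _   = pred-mono-≤ (hi-mono x≤y)
      ... | yes _  | no _    = ≤-trans pred[n]≤n (hi-mono x≤y)
      ... | no x≮c | yes y<c = contradiction (≤-<-trans x≤y y<c) x≮c
      ... | no _   | no _    = hi-mono x≤y

      hi-no≤ : ∀ x → hi-no x ≤ suc H
      hi-no≤ x with x <? c
      ... | yes _ = ≤-trans pred[n]≤n (hi≤ x)
      ... | no  _ = hi≤ x

      weight-ok : ∀ {f h} → (∀ x → f x ≡ h x) →
        2 * weight q f (n * N) ≤ weight (suc q) g (n * N) + 2 ^ suc q →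
        weight q h (n * N) + q * 2 ^ q ≤ K * 2 ^ q
      weight-ok {f} {h} f≡h 2W≤ = *-cancelˡ-≤ 2 (begin
        2 * (weight q h (n * N) + q * 2 ^ q)                 ≡⟨ cong (λ w → 2 * (w + q * 2 ^ q)) (total-cong (cong (V q) ∘ f≡h) (n * N)) ⟨
        2 * (weight q f (n * N) + q * 2 ^ q)                 ≡⟨ double-+ (weight q f (n * N)) q (2 ^ q) ⟩
        2 * weight q f (n * N) + q * 2 ^ suc q               ≤⟨ +-monoˡ-≤ (q * 2 ^ suc q) 2W≤ ⟩
        (weight (suc q) g (n * N) + 2 ^ suc q) + q * 2 ^ suc q ≡⟨ +-assoc (weight (suc q) g (n * N)) (2 ^ suc q) _ ⟩
        weight (suc q) g (n * N) + suc q * 2 ^ suc q         ≤⟨ W≤ ⟩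
        K * 2 ^ suc q                                        ≡⟨ double-* K (2 ^ q) ⟩
        2 * (K * 2 ^ q)                                      ∎)
        where
        open ≤-Reasoning
        double-+ : ∀ w q d → 2 * (w + q * d) ≡ 2 * w + q * (2 * d)
        double-+ = solve-∀
        double-* : ∀ k d → k * (2 * d) ≡ 2 * (k * d)
        double-* = solve-∀

-- Rounding up and the choice of parameters

m≤ceilDivPow2*2^ : ∀ a m → a ≤ ceilDivPow2 a m * 2 ^ m
m≤ceilDivPow2*2^ a m = +-cancelʳ-≤ (2 ^ m ∸ 1) _ _ (begin
  a + (2 ^ m ∸ 1)                                              ≡⟨ m≡m%n+[m/n]*n (a + (2 ^ m ∸ 1)) (2 ^ m) ⟩
  (a + (2 ^ m ∸ 1)) % (2 ^ m) + ceilDivPow2 a m * 2 ^ m        ≤⟨ +-monoˡ-≤ _ (s≤s⁻¹ (<-≤-trans (m%n<n (a + (2 ^ m ∸ 1)) (2 ^ m)) (≤-reflexive (sym (m+[n∸m]≡n (m^n>0 2 m)))))) ⟩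
  (2 ^ m ∸ 1) + ceilDivPow2 a m * 2 ^ m                        ≡⟨ +-comm (2 ^ m ∸ 1) _ ⟩
  ceilDivPow2 a m * 2 ^ m + (2 ^ m ∸ 1)                        ∎)
  where
  open ≤-Reasoning
  instance _ = m^n≢0 2 m

theorem4 : (n k H : ℕ) → 2 * H ≤ k → 1 ≤ n →
    Σ (Algo n k) λ alg →
    (x : Fin n) (as : Vec Bool k) → errors x alg as ≤ H →
    cyc n x (run alg as) ≤ bound n k H
theorem4 n k H 2H≤k 1≤n =
  subst (λ q → Σ (Algo n q) λ alg → ∀ x as → errors x alg as ≤ H → cyc n x (run alg as) ≤ L)
    (m∸n+n≡m (≤-trans (m≤m+n H (H + 0)) 2H≤k))
    -- Budgets are compared strictly, so `H` permitted lies mean an initial budget of `suc H`.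
    (proj₁ strategy , λ x as few → proj₂ strategy x as (s≤s few))
  where
  open ≤-Reasoning
  m N L K : ℕ
  m = k ∸ H
  -- The m cuts cost a total of m points to rounding; two more points cover the
  -- ends of the final interval.
  N = 2 + m
  L = bound n k H
  K = N * L + m

  K-short : suc K < suc L * N
  K-short = ≤-reflexive (rearrange m L)
    where
    rearrange : ∀ m L → suc (suc ((2 + m) * L + m)) ≡ suc L * (2 + m)
    rearrange = solve-∀

  -- The ceiling in `bound` gives `n * S ≤ L * 2 ^ m`, which is scaled by the refinement `N`; the
  -- summand `m` of `K` pays for the roundings.
  initial-weight : weight m (const (suc H)) (n * N) + m * 2 ^ m ≤ K * 2 ^ m
  initial-weight = begin
    weight m (const (suc H)) (n * N) + m * 2 ^ m   ≡⟨ cong (_+ m * 2 ^ m) (total-const (V m (suc H)) (n * N)) ⟩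
    n * N * V m (suc H) + m * 2 ^ m                ≡⟨ cong (λ v → n * N * v + m * 2 ^ m) (sum-map-upTo (m C_) (suc H)) ⟨
    n * N * S + m * 2 ^ m                          ≡⟨ swap n N S (m * 2 ^ m) ⟩
    N * (n * S) + m * 2 ^ m                        ≤⟨ +-monoˡ-≤ (m * 2 ^ m) (*-monoʳ-≤ N (m≤ceilDivPow2*2^ (n * S) m)) ⟩
    N * (L * 2 ^ m) + m * 2 ^ m                    ≡⟨ collect N L m (2 ^ m) ⟩
    K * 2 ^ m                                      ∎
    where
    S : ℕ
    S = sum (map (m C_) (upTo (suc H)))
    swap : ∀ n N s r → n * N * s + r ≡ N * (n * s) + r
    swap = solve-∀
    collect : ∀ N L m d → N * (L * d) + m * d ≡ (N * L + m) * d
    collect = solve-∀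

  open Game n N L
  open Halving (fromℕ< 1≤n) H K K-short

  strategy : Strategy (const (suc H)) (m + H)
  strategy = halve m (const 0) (const (suc H)) (λ _ → z≤n) (λ _ → ≤-refl) (λ _ → ≤-refl) initial-weight
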